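{- Let $p>3$ be a prime integer such that $p\equiv 2 \pmod 3$. The equation $p\cdot 3^x+p^y=z^2$ admits a solution $(x,y,z)\in\mathbb{N}^3$ if and only if $p-2$ is a non-trivial power of $3$. In the affirmative case, the unique solution in $\mathbb{N}^3$ is $(x,y,z)=(\log_3(p-2),\,0,\,p-1)$.
   Context: $\mathbb{N}=\{0,1,2,3,\ldots\}$ denotes the set of non-negative integers, and $\mathbb{N}^{*}=\mathbb{N}\setminus\{0\}$. An integer $h$ is called a non-trivial power of $3$ if $h=3^k$ for some $k\in\mathbb{N}^{*}$. -}

module Defs where

open import Data.Nat using (ℕ; _+_; _*_; _^_; _≥_)
open import Data.Product using (∃-syntax; _×_; _,_; proj₁)
open import Relation.Binary.PropositionalEquality using (_≡_)

NonTrivialPowerOf3 : ℕ → Set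
NonTrivialPowerOf3 h = ∃[ k ] (k ≥ 1 × h ≡ 3 ^ k)

-- The exact base-3 logarithm, defined on powers of 3 only: the k with 3 ^ k ≡ h.
-- It is independent of the witness because 3 ^_ is injective.
log₃ : (h : ℕ) → NonTrivialPowerOf3 h → ℕ
log₃ _ = proj₁

IsSolution : ℕ → ℕ × ℕ × ℕ → Set
IsSolution p (x , y , z) = p * 3 ^ x + p ^ y ≡ z ^ 2

{-# OPTIONS --safe #-}
-- For y ≥ 1, p divides z; writing z = w p and cancelling gives 3 ^ x + p ^ (y − 1) = p w².
-- If y ≥ 2 then p ∣ 3 ^ x, and if y = 1 then −1 is a square mod 3 (or p ∣ 2).
-- For y = 0, p · 3 ^ x = (z − 1)(z + 1), so p divides one factor; as 3 cannot divide both
-- factors, the other factor carries all of 3 ^ x and the factor divisible by p is p itself.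
-- Since p + 2 ≡ 1 (mod 3) is not a power of 3, z − 1 = p is excluded, leaving z + 1 = p.
module Submission where

open import Data.Nat using (ℕ; zero; suc; _+_; _*_; _^_; _∸_; _>_; _%_; _/_; NonZero; z≤n; s≤s)
open import Data.Nat.Coprimality using (coprime-divisor)
open import Data.Nat.Divisibility
open import Data.Nat.DivMod using (m≡m%n+[m/n]*n)
open import Data.Nat.Primality using (Prime; prime?; prime⇒irreducible; prime⇒nonZero; euclidsLemma)
open import Data.Nat.Properties
open import Data.Nat.Tactic.RingSolver using (solve-∀)
open import Data.Product using (∃-syntax; _×_; _,_)
open import Data.Sum using (_⊎_; inj₁; inj₂)
open import Function.Bundles using (_⇔_; mk⇔)
open import Relation.Binary.Definitions using (tri<; tri≈; tri>)
open import Relation.Binary.PropositionalEquality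
  using (_≡_; _≢_; refl; sym; trans; cong; subst; module ≡-Reasoning)
open import Relation.Nullary using (yes; no; contradiction)
open import Relation.Nullary.Decidable using (from-yes; from-no)
open import Defs

-- If `q` does not divide `d`, the two are coprime, so factors `q` can be stripped from the power
-- one by one until `d ∣ 1` remains.
∣prime^⇒≡1⊎prime∣ : ∀ {q d} → Prime q → ∀ n → d ∣ q ^ n → d ≡ 1 ⊎ q ∣ d
∣prime^⇒≡1⊎prime∣ pq zero d∣1 = inj₁ (∣1⇒≡1 d∣1)
∣prime^⇒≡1⊎prime∣ {q} {d} pq (suc n) d∣q^1+n with q ∣? d
... | yes q∣d = inj₂ q∣d
... | no q∤d = ∣prime^⇒≡1⊎prime∣ pq n (coprime-divisor coprime d∣q^1+n)
  where
  coprime : ∀ {i} → i ∣ d × i ∣ q → i ≡ 1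
  coprime (i∣d , i∣q) with prime⇒irreducible pq i∣q
  ... | inj₁ i≡1  = i≡1
  ... | inj₂ refl = contradiction i∣d q∤d

prime[3] : Prime 3
prime[3] = from-yes (prime? 3)

-- The residues 0, 1, 2 are the base cases; raising `w` by 3 changes `1 + w * w` by a multiple of 3.
3∤1+w² : ∀ w → 3 ∤ 1 + w * w
3∤1+w² 0 = from-no (3 ∣? 1)
3∤1+w² 1 = from-no (3 ∣? 2)
3∤1+w² 2 = from-no (3 ∣? 5)
3∤1+w² (suc (suc (suc w))) 3∣ =
  3∤1+w² w (∣m+n∣m⇒∣n (subst (3 ∣_) (shift w) 3∣) (m∣m*n (2 * w + 3)))
  where
  shift : ∀ w → 1 + (3 + w) * (3 + w) ≡ 3 * (2 * w + 3) + (1 + w * w)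
  shift = solve-∀

-- With `z = suc m`, the factors `z − 1` and `z + 1` become `m` and `2 + m`, which avoids truncated
-- subtraction.
[1+m]²≡1+m[2+m] : ∀ m → suc m ^ 2 ≡ suc (m * (2 + m))
[1+m]²≡1+m[2+m] = expand
  where
  expand : ∀ m → suc m * (suc m * 1) ≡ suc (m * (2 + m))
  expand = solve-∀

3^-injective : ∀ {m n} → 3 ^ m ≡ 3 ^ n → m ≡ n
3^-injective {m} {n} eq with <-cmp m n
... | tri< m<n _ _ = contradiction eq (<⇒≢ (^-monoʳ-< 3 (s≤s (s≤s z≤n)) m<n))
... | tri≈ _ m≡n _ = m≡n
... | tri> _ _ n<m = contradiction (sym eq) (<⇒≢ (^-monoʳ-< 3 (s≤s (s≤s z≤n)) n<m))

module _ {p : ℕ} (pp : Prime p) (p>3 : p > 3) (p%3≡2 : p % 3 ≡ 2) where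

  private instance
    p≢0 : NonZero p
    p≢0 = prime⇒nonZero pp

  -- The congruence on `p` enters the later arguments in this form.
  3∣1+p : 3 ∣ 1 + p
  3∣1+p = divides (1 + p / 3)
    (cong suc (trans (m≡m%n+[m/n]*n p 3) (cong (_+ p / 3 * 3) p%3≡2)))

  p∤3^ : ∀ x → p ∤ 3 ^ x
  p∤3^ x p∣3^x with ∣prime^⇒≡1⊎prime∣ prime[3] x p∣3^x
  ... | inj₁ refl = contradiction p>3 λ { (s≤s ()) }
  ... | inj₂ 3∣p  = from-no (3 ∣? 1) (∣m+n∣m⇒∣n (subst (3 ∣_) (+-comm 1 p) 3∣1+p) 3∣p)

  3^x≢2+p : ∀ x → 3 ^ x ≢ 2 + p
  3^x≢2+p zero    ()
  3^x≢2+p (suc x) eq =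
    from-no (3 ∣? 1) (∣m+n∣m⇒∣n (subst (3 ∣_) (trans eq (+-comm 1 (1 + p))) (m∣m*n (3 ^ x))) 3∣1+p)

  3^x+1≢pw² : ∀ x w → 3 ^ x + 1 ≢ p * (w * w)
  3^x+1≢pw² zero    w eq =
    -- For `x = 0` the left side is 2, so `p ∣ 2`.
    <⇒≱ p>3 (≤-trans (∣⇒≤ (subst (p ∣_) (sym eq) (m∣m*n (w * w)))) (n≤1+n 2))
  3^x+1≢pw² (suc x) w eq = 3∤1+w² w (∣m+n∣m⇒∣n 3∣sum (m∣m*n (3 ^ x)))
    where
    -- Adding `w * w` to both sides produces the factor `1 + p`, a multiple of 3, and so forces
    -- `3 ∣ 1 + w * w`.
    sum-eq : 3 ^ suc x + (1 + w * w) ≡ (1 + p) * (w * w)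
    sum-eq = begin
      3 ^ suc x + (1 + w * w)   ≡⟨ +-assoc (3 ^ suc x) 1 (w * w) ⟨
      3 ^ suc x + 1 + w * w     ≡⟨ cong (_+ w * w) eq ⟩
      p * (w * w) + w * w       ≡⟨ +-comm (p * (w * w)) (w * w) ⟩
      (1 + p) * (w * w)         ∎
      where open ≡-Reasoning

    3∣sum : 3 ∣ 3 ^ suc x + (1 + w * w)
    3∣sum = subst (3 ∣_) (sym sum-eq) (∣m⇒∣m*n (w * w) 3∣1+p)

  -- Here `y` is one less than the exponent in the original equation, a factor `p` having been
  -- cancelled.
  3^x+p^y≢pw² : ∀ x y w → 3 ^ x + p ^ y ≢ p * (w * w)
  3^x+p^y≢pw² x zero    w eq = 3^x+1≢pw² x w eq
  3^x+p^y≢pw² x (suc y) w eq = p∤3^ x (∣m+n∣m⇒∣n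
    (subst (p ∣_) (trans (sym eq) (+-comm (3 ^ x) (p ^ suc y))) (m∣m*n (w * w)))
    (m∣m*n (p ^ y)))

  no-solution-y>0 : ∀ x y z → p * 3 ^ x + p ^ suc y ≢ z ^ 2
  no-solution-y>0 x y z eq = ∤z p∣z
    where
    z² : z ^ 2 ≡ z * z
    z² = cong (z *_) (*-identityʳ z)

    p∣z : p ∣ z
    p∣z with euclidsLemma z z pp (subst (p ∣_) (trans eq z²)
                 (∣m∣n⇒∣m+n (m∣m*n (3 ^ x)) (m∣m*n (p ^ y))))
    ... | inj₁ h = h
    ... | inj₂ h = h

    ∤z : p ∤ z
    ∤z (divides w z≡wp) = 3^x+p^y≢pw² x y w (*-cancelˡ-≡ _ _ p (begin
      p * (3 ^ x + p ^ y)     ≡⟨ *-distribˡ-+ p (3 ^ x) (p ^ y) ⟩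
      p * 3 ^ x + p ^ suc y   ≡⟨ eq ⟩
      z ^ 2                   ≡⟨ z² ⟩
      z * z                   ≡⟨ cong (λ v → v * v) z≡wp ⟩
      w * p * (w * p)         ≡⟨ square w p ⟩
      p * (p * (w * w))       ∎))
      where
      open ≡-Reasoning
      square : ∀ w p → w * p * (w * p) ≡ p * (p * (w * w))
      square = solve-∀

  -- This is the case `z − 1 = q * p` after cancelling `p`. Either `q = 1`, or 3 divides both `q`
  -- and `2 + q * p`, hence 2.
  3^x≢q[2+qp] : ∀ x q → 3 ^ x ≢ q * (2 + q * p)
  3^x≢q[2+qp] x q eq with ∣prime^⇒≡1⊎prime∣ prime[3] x (subst (q ∣_) (sym eq) (m∣m*n _))
  ... | inj₁ refl = 3^x≢2+p x (trans eq (trans (*-identityˡ _) (cong (2 +_) (*-identityˡ p))))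
  ... | inj₂ 3∣q with ∣prime^⇒≡1⊎prime∣ prime[3] x (subst (2 + q * p ∣_) (sym eq) (n∣m*n q))
  ...   | inj₁ ()
  ...   | inj₂ 3∣2+qp = from-no (3 ∣? 2)
    (∣m+n∣m⇒∣n (subst (3 ∣_) (+-comm 2 (q * p)) 3∣2+qp) (∣m⇒∣m*n p 3∣q))

  -- This is the case `z + 1 = q * p`, with `m = z − 1`. If 3 divided both `q` and `m`, it would
  -- divide `q * p − m = 2`.
  3^x≡mq⇒q≡1 : ∀ x m q → 2 + m ≡ q * p → 3 ^ x ≡ m * q → q ≡ 1
  3^x≡mq⇒q≡1 x m q 2+m≡qp eq with ∣prime^⇒≡1⊎prime∣ prime[3] x (subst (q ∣_) (sym eq) (n∣m*n m))
  ... | inj₁ q≡1 = q≡1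
  ... | inj₂ 3∣q with ∣prime^⇒≡1⊎prime∣ prime[3] x (subst (m ∣_) (sym eq) (m∣m*n q))
  -- With `m = 1` the hypothesis reads `3 = q * p`, so `p ≤ 3`.
  ...   | inj₁ refl = contradiction (∣⇒≤ (divides q 2+m≡qp)) (<⇒≱ p>3)
  ...   | inj₂ 3∣m  = contradiction (∣m+n∣m⇒∣n
    (subst (3 ∣_) (trans (sym 2+m≡qp) (+-comm 2 m)) (∣m⇒∣m*n p 3∣q)) 3∣m) (from-no (3 ∣? 2))

  p3^x≡m[2+m]⇒m≡3^x : ∀ x m → p * 3 ^ x ≡ m * (2 + m) → m ≡ 3 ^ x × p ≡ 2 + 3 ^ x
  p3^x≡m[2+m]⇒m≡3^x x m eq with euclidsLemma m (2 + m) pp (subst (p ∣_) eq (m∣m*n (3 ^ x)))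
  ... | inj₁ (divides q refl) = contradiction
    (*-cancelˡ-≡ _ _ p (trans eq (swap q p))) (3^x≢q[2+qp] x q)
    where
    swap : ∀ q p → q * p * (2 + q * p) ≡ p * (q * (2 + q * p))
    swap = solve-∀
  ... | inj₂ (divides q 2+m≡qp) = conclude (3^x≡mq⇒q≡1 x m q 2+m≡qp 3^x≡mq)
    where
    swap : ∀ m q p → m * (q * p) ≡ p * (m * q)
    swap = solve-∀

    3^x≡mq : 3 ^ x ≡ m * q
    3^x≡mq = *-cancelˡ-≡ _ _ p (trans eq (trans (cong (m *_) 2+m≡qp) (swap m q p)))

    conclude : q ≡ 1 → m ≡ 3 ^ x × p ≡ 2 + 3 ^ x
    conclude refl = m≡3^x , trans (sym (*-identityˡ p)) (trans (sym 2+m≡qp) (cong (2 +_) m≡3^x))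
      where
      m≡3^x : m ≡ 3 ^ x
      m≡3^x = sym (trans 3^x≡mq (*-identityʳ m))

  solution-shape : ∀ x y z → IsSolution p (x , y , z) → y ≡ 0 × z ≡ 1 + 3 ^ x × p ≡ 2 + 3 ^ x
  solution-shape x (suc y) z eq = contradiction eq (no-solution-y>0 x y z)
  solution-shape x zero zero eq = contradiction (trans (+-comm 1 _) eq) λ ()
  solution-shape x zero (suc m) eq
    with m≡3^x , p≡2+3^x ← p3^x≡m[2+m]⇒m≡3^x x m
           (suc-injective (trans (+-comm 1 _) (trans eq ([1+m]²≡1+m[2+m] m))))
    = refl , cong suc m≡3^x , p≡2+3^x

  solution⇒power : (∃[ s ] IsSolution p s) → NonTrivialPowerOf3 (p ∸ 2)
  solution⇒power ((x , y , z) , sol) with solution-shape x y z sol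
  -- The exponent 0 would give `p = 3`; this is what makes the power non-trivial.
  solution⇒power ((zero , _) , _)  | _ , _ , p≡3 = contradiction (sym p≡3) (<⇒≢ p>3)
  solution⇒power ((suc x , _) , _) | _ , _ , p≡2+3^x = suc x , s≤s z≤n , cong (_∸ 2) p≡2+3^x

  power⇒p≡2+3^k : ∀ {k} → p ∸ 2 ≡ 3 ^ k → p ≡ 2 + 3 ^ k
  power⇒p≡2+3^k eq = trans (sym (m+[n∸m]≡n (≤-trans (n≤1+n 2) (<⇒≤ p>3)))) (cong (2 +_) eq)

  power⇒solution : (pow : NonTrivialPowerOf3 (p ∸ 2)) → IsSolution p (log₃ (p ∸ 2) pow , 0 , p ∸ 1)
  power⇒solution (k , _ , eq) =
    -- Writing `p = 2 + t` with `t = 3 ^ k` turns the equation into `(2 + t) * t + 1 = (1 + t) ^ 2`.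
    subst (λ v → v * 3 ^ k + 1 ≡ (v ∸ 1) ^ 2) (sym (power⇒p≡2+3^k {k} eq)) (square (3 ^ k))
    where
    square : ∀ t → (2 + t) * t + 1 ≡ (1 + t) * ((1 + t) * 1)
    square = solve-∀

  solution-unique : (pow : NonTrivialPowerOf3 (p ∸ 2)) →
    ∀ s → IsSolution p s → s ≡ (log₃ (p ∸ 2) pow , 0 , p ∸ 1)
  solution-unique (k , _ , eq) (x , y , z) sol with solution-shape x y z sol
  ... | refl , refl , p≡2+3^x
    -- Both `3 ^ x` and `3 ^ k` equal `p ∸ 2`, so the exponent found agrees with the one carried by
    -- the witness.
    with refl ← 3^-injective {x} {k} (trans (sym (cong (_∸ 2) p≡2+3^x)) eq)
    = cong (λ v → k , 0 , v) (sym (cong (_∸ 1) p≡2+3^x))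

theorem0p13 : (p : ℕ) → Prime p → p > 3 → p % 3 ≡ 2 →
    ((∃[ s ] IsSolution p s) ⇔ NonTrivialPowerOf3 (p ∸ 2))
    × ((pow : NonTrivialPowerOf3 (p ∸ 2)) →
    IsSolution p (log₃ (p ∸ 2) pow , 0 , p ∸ 1)
    × (∀ s → IsSolution p s → s ≡ (log₃ (p ∸ 2) pow , 0 , p ∸ 1)))
theorem0p13 p pp p>3 p%3≡2 =
  mk⇔ (solution⇒power pp p>3 p%3≡2) (λ pow → (log₃ (p ∸ 2) pow , 0 , p ∸ 1) , power⇒solution pp p>3 p%3≡2 pow) ,
  (λ pow → power⇒solution pp p>3 p%3≡2 pow , solution-unique pp p>3 p%3≡2 pow)
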